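{- For every $\delta>0$ there exists $q_0(\delta)$ such that for every prime power $q\ge q_0(\delta)$, the family $\mathcal A(q)$ of all arcs in $\mathbb F_q^2$ satisfies \[ |\mathcal A(q)| \leq 2^{q+2q^{\frac{4}{5}+\delta}}. \] In particular, $|\mathcal A(q)| \leq 2^{(1+o(1))q}$ as $q\to\infty$.
   Context: $\mathbb F_q$ denotes the finite field with $q$ elements. An arc in $\mathbb F_q^2$ is a set $P\subseteq \mathbb F_q^2$ such that no three distinct points of $P$ lie on a common (affine) line. $\mathcal A(q)$ denotes the family of all arcs in $\mathbb F_q^2$ (including the empty set and all small sets). -}

module Defs where

open import Level using (0ℓ)
open import Data.Nat using (ℕ)
open import Data.Fin using (Fin)
open import Data.Bool using (Bool; true)
open import Data.Vec using (Vec; lookup)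
open import Data.Product using (Σ; ∃; _×_; _,_)
open import Relation.Nullary using (¬_)
open import Relation.Binary.PropositionalEquality using (_≡_; _≢_)
open import Algebra.Bundles using (CommutativeRing)

record IsField (R : CommutativeRing 0ℓ 0ℓ) : Set where
  open CommutativeRing R
  field
    nontrivial : ¬ (1# ≈ 0#)
    inverse    : ∀ x → ¬ (x ≈ 0#) → ∃ λ y → (x * y) ≈ 1#

record FiniteField (q : ℕ) : Set₁ where
  field
    cring     : CommutativeRing 0ℓ 0ℓ
    isField   : IsField cring
  open CommutativeRing cring public
  field
    enum            : Fin q → Carrier
    enum-injective  : ∀ i j → enum i ≈ enum j → i ≡ j
    enum-surjective : ∀ x → ∃ λ i → enum i ≈ x

-- Points of F_q^2 are indexed by pairs of indices (via the enumeration).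
Point : ℕ → Set
Point q = Fin q × Fin q

PointSet : ℕ → Set
PointSet q = Vec (Vec Bool q) q

_∈ₚ_ : ∀ {q} → Point q → PointSet q → Set
(i , j) ∈ₚ S = lookup (lookup S i) j ≡ true

module _ {q : ℕ} (F : FiniteField q) where
  open FiniteField F

  OnLine : Carrier → Carrier → Carrier → Point q → Set
  OnLine a b c (i , j) = ((a * enum i) + (b * enum j)) ≈ c

  Collinear : Point q → Point q → Point q → Set
  Collinear P₁ P₂ P₃ =
    Σ Carrier λ a → Σ Carrier λ b → Σ Carrier λ c →
      ¬ (a ≈ 0# × b ≈ 0#) × OnLine a b c P₁ × OnLine a b c P₂ × OnLine a b c P₃

  IsArc : PointSet q → Set
  IsArc S = ∀ P₁ P₂ P₃ → P₁ ∈ₚ S → P₂ ∈ₚ S → P₃ ∈ₚ S →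
            P₁ ≢ P₂ → P₁ ≢ P₃ → P₂ ≢ P₃ → ¬ Collinear P₁ P₂ P₃

{-# OPTIONS --safe #-}
module Submission where

open import Defs
open import Algebra.Bundles using (CommutativeRing)
open import Data.Bool using (Bool; true; false; if_then_else_)
import Data.Bool.Properties as Bool
open import Data.Empty using (⊥; ⊥-elim)
open import Data.Fin using (Fin; zero; suc)
import Data.Fin.Properties as Fin
open import Data.List using (List; []; _∷_; length; map; filter; allFin; cartesianProduct)
open import Data.List.Properties using (filter-none; filter-notAll; length-++; length-filter; length-map; length-tabulate)
open import Data.List.Membership.Propositional using (_∈_; _∉_; find; lose)
open import Data.List.Membership.Propositional.Properties using (∈-allFin; ∈-cartesianProduct⁺; ∈-filter⁺; ∈-filter⁻)
open import Data.List.Relation.Unary.All as All using (All; []; _∷_)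
open import Data.List.Relation.Unary.AllPairs using ([]; _∷_)
open import Data.List.Relation.Unary.Any using (Any; here; there; any?)
open import Data.List.Relation.Unary.Unique.Propositional using (Unique)
open import Data.List.Relation.Unary.Unique.Propositional.Properties using (allFin⁺; cartesianProduct⁺; filter⁺)
open import Data.Maybe using (nothing)
open import Data.Nat using (ℕ; zero; suc; _≤_; _<_; _*_; _+_; _^_; _≤?_; z≤n; s≤s; s≤s⁻¹; >-nonZero)
open import Data.Nat.Tactic.RingSolver using (solve-∀)
open import Data.Product using (Σ; ∃; _×_; _,_; proj₁; proj₂)
open import Data.Product.Properties using (≡-dec)
open import Data.Sum using (inj₁; inj₂)
open import Data.Vec using (lookup)
open import Data.Vec.Relation.Binary.Pointwise.Extensional using (ext; Pointwise-≡⇒≡)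
open import Function using (_∘_; id)
open import Level using (0ℓ)
open import Relation.Binary.Definitions using (DecidableEquality)
open import Relation.Binary.PropositionalEquality using (_≡_; _≢_; refl; sym; trans; cong; cong₂; subst; subst₂; module ≡-Reasoning)
open import Relation.Nullary using (¬_; Dec; yes; no; does; contradiction)
open import Relation.Nullary.Decidable using (¬?; _×-dec_)
open import Tactic.RingSolver using () renaming (solve-∀ to solve-∀ᴿ)
open import Tactic.RingSolver.Core.AlmostCommutativeRing using (AlmostCommutativeRing; fromCommutativeRing)

-- Fix s points S of an arc A.  Two further points of A are never collinear with a point of S, so the
-- rest of A is independent in the graph joining x and y when the line xy meets S.  If n points T are
-- left, then for each v in S the q + 1 lines through v yield, by Cauchy–Schwarz, at least n²/(q+1)
-- ordered pairs in T × T lying on a common line through v, and since S is an arc every pair x ≠ y is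
-- obtained from at most two v.  Hence for n > (1 + ε)(q + 1) some vertex has degree at least a
-- constant times nsε/q.  Branching on such vertices (the Kleitman–Winston recursion), O((q/sε) log q)
-- selected points of A leave at most (1 + ε)(q + 1) candidates for the others.
-- With s = q^(3/5) and ε = q^(-1/5) this costs q^(3/5) polylog(q) bits on top of q + O(q^(4/5)).

-- Directions in the affine plane

module RingIdentities (R : CommutativeRing 0ℓ 0ℓ) where

  private
    R′ : AlmostCommutativeRing 0ℓ 0ℓ
    R′ = fromCommutativeRing R (λ _ → nothing)
  open AlmostCommutativeRing R′ renaming (_+_ to _⊕_; _*_ to _⊗_)

  -- In the uses `e` is a difference of first coordinates and `g` a difference of slope parameters.
  -- Writing the larger expressions as sums such as `e ⊕ i` keeps subtraction out of the identities;
  -- `split-off` brings coordinates into this form.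
  shift : ∀ e i j k → j ⊕ k ⊗ (e ⊕ i) ≈ k ⊗ e ⊕ j ⊕ k ⊗ i
  shift = solve-∀ᴿ R′

  slope-shift : ∀ e g i j k → j ⊕ (g ⊕ k) ⊗ (e ⊕ i) ≈ g ⊗ e ⊕ g ⊗ i ⊕ (j ⊕ k ⊗ (e ⊕ i))
  slope-shift = solve-∀ᴿ R′

  slope-collect : ∀ e g i j k → g ⊗ e ⊕ g ⊗ i ⊕ (j ⊕ k ⊗ i) ≈ g ⊗ e ⊕ (j ⊕ (g ⊕ k) ⊗ i)
  slope-collect = solve-∀ᴿ R′

module Directions {q : ℕ} (F : FiniteField q) where
  open FiniteField F
    renaming (refl to ≈-refl; sym to ≈-sym; trans to ≈-trans; _+_ to _⊕_; _*_ to _⊗_; -_ to ⊝_)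
    hiding (_-_; zero)
  open IsField isField
  open RingIdentities cring
  open import Algebra.Properties.Ring (CommutativeRing.ring cring) using (+-cancelʳ)
  open import Relation.Binary.Reasoning.Setoid setoid

  _≟ₚ_ : DecidableEquality (Point q)
  _≟ₚ_ = ≡-dec Fin._≟_ Fin._≟_

  -- The direction zero is vertical and suc k has slope - enum k; the lines in direction d are the
  -- level sets of intercept d.
  intercept : Fin (suc q) → Point q → Carrier
  intercept zero    (i , j) = enum i
  intercept (suc k) (i , j) = enum j ⊕ enum k ⊗ enum i

  split-off : ∀ x y → x ≈ (x ⊕ ⊝ y) ⊕ y
  split-off x y = ≈-sym (≈-trans (+-assoc x (⊝ y) y) (≈-trans (+-congˡ (-‿inverseˡ y)) (+-identityʳ x)))

  difference≈0 : ∀ {x y} → x ⊕ ⊝ y ≈ 0# → x ≈ y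
  difference≈0 {x} {y} eq = ≈-trans (split-off x y) (≈-trans (+-congʳ eq) (+-identityˡ y))

  difference≉0 : ∀ {i i′} → i ≢ i′ → ¬ (enum i ⊕ ⊝ enum i′ ≈ 0#)
  difference≉0 i≢i′ eq = i≢i′ (enum-injective _ _ (difference≈0 eq))

  same-slope : ∀ (p x : Point q) → proj₁ p ≢ proj₁ x → ∃ λ k → intercept (suc k) p ≈ intercept (suc k) x
  same-slope (i , j) (i′ , j′) i≢i′
    with z , inv ← inverse (enum i ⊕ ⊝ enum i′) (difference≉0 i≢i′)
    -- The parameter solves j + k i = j′ + k i′, that is, k = (j′ - j) / (i - i′).
    with k , k≈ ← enum-surjective ((enum j′ ⊕ ⊝ enum j) ⊗ z) = k , (begin
    enum j ⊕ enum k ⊗ enum i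
      ≈⟨ +-congˡ (*-congˡ (split-off (enum i) (enum i′))) ⟩
    enum j ⊕ enum k ⊗ (enum i ⊕ ⊝ enum i′ ⊕ enum i′)
      ≈⟨ shift (enum i ⊕ ⊝ enum i′) (enum i′) (enum j) (enum k) ⟩
    enum k ⊗ (enum i ⊕ ⊝ enum i′) ⊕ enum j ⊕ enum k ⊗ enum i′
      ≈⟨ +-congʳ (+-congʳ rise) ⟩
    enum j′ ⊕ ⊝ enum j ⊕ enum j ⊕ enum k ⊗ enum i′
      ≈⟨ +-congʳ (split-off (enum j′) (enum j)) ⟨
    enum j′ ⊕ enum k ⊗ enum i′ ∎)
    where
    rise : enum k ⊗ (enum i ⊕ ⊝ enum i′) ≈ enum j′ ⊕ ⊝ enum j
    rise = begin
      enum k ⊗ (enum i ⊕ ⊝ enum i′)                          ≈⟨ *-congʳ k≈ ⟩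
      (enum j′ ⊕ ⊝ enum j) ⊗ z ⊗ (enum i ⊕ ⊝ enum i′)        ≈⟨ *-assoc _ _ _ ⟩
      (enum j′ ⊕ ⊝ enum j) ⊗ (z ⊗ (enum i ⊕ ⊝ enum i′))      ≈⟨ *-congˡ (≈-trans (*-comm _ _) inv) ⟩
      (enum j′ ⊕ ⊝ enum j) ⊗ 1#                              ≈⟨ *-identityʳ _ ⟩
      enum j′ ⊕ ⊝ enum j                                     ∎

  common-direction : ∀ p x → ∃ λ d → intercept d p ≈ intercept d x
  common-direction p x with proj₁ p Fin.≟ proj₁ x
  ... | yes eq = zero , reflexive (cong enum eq)
  ... | no neq with k , eq ← same-slope p x neq = suc k , eq

  -- For coinciding points the value is the vertical direction `zero`, and `dir-sound` holds there
  -- as well.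
  dir : Point q → Point q → Fin (suc q)
  dir p x = proj₁ (common-direction p x)

  dir-sound : ∀ p x → intercept (dir p x) p ≈ intercept (dir p x) x
  dir-sound p x = proj₂ (common-direction p x)

  vertical-and-sloped : ∀ {k p x} → intercept zero p ≈ intercept zero x →
                        intercept (suc k) p ≈ intercept (suc k) x → p ≡ x
  vertical-and-sloped {k} {i , j} {i′ , j′} eq₀ eq with refl ← enum-injective i i′ eq₀ =
    cong (i ,_) (enum-injective j j′ (+-cancelʳ _ _ _ eq))

  -- For two different slopes, subtracting the level equations leaves (k - k′)(i - i′) = 0. A field
  -- has no zero divisors, so the first coordinates agree, and then either equation forces the
  -- points to coincide.
  direction-unique : ∀ {p x} → p ≢ x → ∀ d d′ → intercept d p ≈ intercept d x →
                     intercept d′ p ≈ intercept d′ x → d ≡ d′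
  direction-unique p≢x zero    zero     _  _   = refl
  direction-unique p≢x zero    (suc k)  eq eq′ = contradiction (vertical-and-sloped {k} eq eq′) p≢x
  direction-unique p≢x (suc k) zero     eq eq′ = contradiction (vertical-and-sloped {k} eq′ eq) p≢x
  direction-unique {i , j} {i′ , j′} p≢x (suc k) (suc k′) eq eq′ with k Fin.≟ k′
  ... | yes refl = refl
  ... | no k≢k′ = contradiction
    (vertical-and-sloped {k} (difference≈0 (cancel (difference≉0 k≢k′) product≈0)) eq) p≢x
    where
    cancel : ∀ {x y} → ¬ (x ≈ 0#) → x ⊗ y ≈ 0# → y ≈ 0#
    cancel {x} {y} x≉0 xy≈0 with z , xz≈1 ← inverse x x≉0 = begin
      y             ≈⟨ *-identityˡ y ⟨
      1# ⊗ y        ≈⟨ *-congʳ (≈-trans (*-comm z x) xz≈1) ⟨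
      z ⊗ x ⊗ y     ≈⟨ *-assoc z x y ⟩
      z ⊗ (x ⊗ y)   ≈⟨ *-congˡ xy≈0 ⟩
      z ⊗ 0#        ≈⟨ zeroʳ z ⟩
      0#            ∎
    e = enum i ⊕ ⊝ enum i′
    g = enum k ⊕ ⊝ enum k′
    product≈0 : g ⊗ e ≈ 0#
    product≈0 = +-cancelʳ (enum j′ ⊕ (g ⊕ enum k′) ⊗ enum i′) _ _ (begin
      g ⊗ e ⊕ (enum j′ ⊕ (g ⊕ enum k′) ⊗ enum i′)
        ≈⟨ slope-collect e g (enum i′) (enum j′) (enum k′) ⟨
      g ⊗ e ⊕ g ⊗ enum i′ ⊕ (enum j′ ⊕ enum k′ ⊗ enum i′)
        ≈⟨ +-congˡ eq′ ⟨
      g ⊗ e ⊕ g ⊗ enum i′ ⊕ (enum j ⊕ enum k′ ⊗ enum i)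
        ≈⟨ +-congˡ (+-congˡ (*-congˡ (split-off (enum i) (enum i′)))) ⟩
      g ⊗ e ⊕ g ⊗ enum i′ ⊕ (enum j ⊕ enum k′ ⊗ (e ⊕ enum i′))
        ≈⟨ slope-shift e g (enum i′) (enum j) (enum k′) ⟨
      enum j ⊕ (g ⊕ enum k′) ⊗ (e ⊕ enum i′)
        ≈⟨ +-congˡ (*-cong (split-off (enum k) (enum k′)) (split-off (enum i) (enum i′))) ⟨
      enum j ⊕ enum k ⊗ enum i
        ≈⟨ eq ⟩
      enum j′ ⊕ enum k ⊗ enum i′
        ≈⟨ +-congˡ (*-congʳ (split-off (enum k) (enum k′))) ⟩
      enum j′ ⊕ (g ⊕ enum k′) ⊗ enum i′
        ≈⟨ +-identityˡ _ ⟨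
      0# ⊕ (enum j′ ⊕ (g ⊕ enum k′) ⊗ enum i′) ∎)

  level⇒collinear : ∀ d P₁ P₂ P₃ → intercept d P₁ ≈ intercept d P₂ → intercept d P₁ ≈ intercept d P₃ →
                    Collinear F P₁ P₂ P₃
  level⇒collinear zero P₁ P₂ P₃ eq₂ eq₃ =
    1# , 0# , intercept zero P₁ , nontrivial ∘ proj₁ , on P₁ ,
    ≈-trans (on P₂) (≈-sym eq₂) , ≈-trans (on P₃) (≈-sym eq₃)
    where
    on : ∀ P → OnLine F 1# 0# (intercept zero P) P
    on (i , j) = ≈-trans (+-cong (*-identityˡ _) (zeroˡ _)) (+-identityʳ _)
  level⇒collinear (suc k) P₁ P₂ P₃ eq₂ eq₃ =
    enum k , 1# , intercept (suc k) P₁ , nontrivial ∘ proj₂ , on P₁ ,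
    ≈-trans (on P₂) (≈-sym eq₂) , ≈-trans (on P₃) (≈-sym eq₃)
    where
    on : ∀ P → OnLine F (enum k) 1# (intercept (suc k) P) P
    on (i , j) = ≈-trans (+-congˡ (*-identityˡ _)) (+-comm _ _)

  dir-collinear : ∀ v x y → dir v x ≡ dir v y → Collinear F v x y
  dir-collinear v x y eq = level⇒collinear (dir v x) v x y (dir-sound v x)
    (subst (λ d → intercept d v ≈ intercept d y) (sym eq) (dir-sound v y))

  -- Both `x` and `y` lie on the level of `v` in direction `dir v x`, so by uniqueness this
  -- direction is that of the line xy.
  dir-on-line : ∀ {v x y} → x ≢ y → dir v x ≡ dir v y → intercept (dir x y) v ≈ intercept (dir x y) x
  dir-on-line {v} {x} {y} x≢y eq =
    subst (λ d → intercept d v ≈ intercept d x) dir≡ (dir-sound v x)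
    where
    v≈y : intercept (dir v x) v ≈ intercept (dir v x) y
    v≈y = subst (λ d → intercept d v ≈ intercept d y) (sym eq) (dir-sound v y)
    dir≡ : dir v x ≡ dir x y
    dir≡ = direction-unique x≢y (dir v x) (dir x y) (≈-trans (≈-sym (dir-sound v x)) v≈y) (dir-sound x y)

  -- All three points lie on the line xy. Hence a pair `x`, `y` is seen in one direction from at
  -- most two points of an arc.
  three-on-line : ∀ {x y v₁ v₂ v₃} → x ≢ y → dir v₁ x ≡ dir v₁ y → dir v₂ x ≡ dir v₂ y →
                  dir v₃ x ≡ dir v₃ y → Collinear F v₁ v₂ v₃
  three-on-line {x} {y} {v₁} {v₂} {v₃} x≢y eq₁ eq₂ eq₃ = level⇒collinear (dir x y) v₁ v₂ v₃
    (≈-trans (dir-on-line x≢y eq₁) (≈-sym (dir-on-line x≢y eq₂)))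
    (≈-trans (dir-on-line x≢y eq₁) (≈-sym (dir-on-line x≢y eq₃)))

open import Data.Nat.Properties

-- Finite sums

∑ : {A : Set} → List A → (A → ℕ) → ℕ
∑ []       f = 0
∑ (x ∷ xs) f = f x + ∑ xs f

syntax ∑ xs (λ x → e) = ∑[ x ∈ xs ] e

𝟙 : {P : Set} → Dec P → ℕ
𝟙 d = if does d then 1 else 0

module _ {A : Set} where

  ∑-mono : ∀ (xs : List A) {f g} → (∀ {x} → x ∈ xs → f x ≤ g x) → ∑ xs f ≤ ∑ xs g
  ∑-mono []       f≤g = z≤n
  ∑-mono (x ∷ xs) f≤g = +-mono-≤ (f≤g (here refl)) (∑-mono xs (f≤g ∘ there))

  ∑-cong : ∀ (xs : List A) {f g} → (∀ x → f x ≡ g x) → ∑ xs f ≡ ∑ xs g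
  ∑-cong []       f≡g = refl
  ∑-cong (x ∷ xs) f≡g = cong₂ _+_ (f≡g x) (∑-cong xs f≡g)

  ∑-const : ∀ (xs : List A) c → ∑[ _ ∈ xs ] c ≡ length xs * c
  ∑-const []       c = refl
  ∑-const (x ∷ xs) c = cong (c +_) (∑-const xs c)

  ∑-+ : ∀ (xs : List A) f g → ∑[ x ∈ xs ] (f x + g x) ≡ ∑ xs f + ∑ xs g
  ∑-+ []       f g = refl
  ∑-+ (x ∷ xs) f g = begin
    f x + g x + ∑[ y ∈ xs ] (f y + g y)  ≡⟨ cong (f x + g x +_) (∑-+ xs f g) ⟩
    f x + g x + (∑ xs f + ∑ xs g)        ≡⟨ lemma (f x) (g x) (∑ xs f) (∑ xs g) ⟩
    f x + ∑ xs f + (g x + ∑ xs g)        ∎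
    where
    open ≡-Reasoning
    lemma : ∀ a b c d → a + b + (c + d) ≡ a + c + (b + d)
    lemma = solve-∀

  *-distribˡ-∑ : ∀ c (xs : List A) f → c * ∑ xs f ≡ ∑[ x ∈ xs ] (c * f x)
  *-distribˡ-∑ c []       f = *-zeroʳ c
  *-distribˡ-∑ c (x ∷ xs) f =
    trans (*-distribˡ-+ c (f x) (∑ xs f)) (cong (c * f x +_) (*-distribˡ-∑ c xs f))

  ∑-𝟙 : {P : A → Set} (P? : ∀ x → Dec (P x)) (xs : List A) →
        ∑[ x ∈ xs ] 𝟙 (P? x) ≡ length (filter P? xs)
  ∑-𝟙 P? []       = refl
  ∑-𝟙 P? (x ∷ xs) with does (P? x)
  ... | true  = cong suc (∑-𝟙 P? xs)
  ... | false = ∑-𝟙 P? xs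

  length-filter-split : {P : A → Set} (P? : ∀ x → Dec (P x)) (xs : List A) →
                        length (filter P? xs) + length (filter (¬? ∘ P?) xs) ≡ length xs
  length-filter-split P? []       = refl
  length-filter-split P? (x ∷ xs) with does (P? x)
  ... | true  = cong suc (length-filter-split P? xs)
  ... | false = trans (+-suc _ _) (cong suc (length-filter-split P? xs))

  ∑-pigeonhole : ∀ c (xs : List A) f → 0 < length xs → length xs * c ≤ ∑ xs f →
                 Any (λ x → c ≤ f x) xs
  ∑-pigeonhole c (x ∷ xs) f _ le with c ≤? f x
  ... | yes c≤fx = here c≤fx
  ... | no  c≰fx = there (∑-pigeonhole c xs f (nonempty xs le)
    (+-cancelˡ-≤ c _ _ (≤-trans le (+-monoˡ-≤ _ (<⇒≤ (≰⇒> c≰fx))))))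
    where
    -- An empty tail would turn the inequality into `c ≤ f x`.
    nonempty : ∀ xs → c + length xs * c ≤ f x + ∑ xs f → 0 < length xs
    nonempty []      le = contradiction (+-cancelʳ-≤ 0 c (f x) le) c≰fx
    nonempty (_ ∷ _) le = s≤s z≤n

  module _ (_≟_ : DecidableEquality A) where

    ∑-𝟙-∈ : ∀ {x xs} → Unique xs → x ∈ xs → (f : A → ℕ) → ∑[ y ∈ xs ] (𝟙 (x ≟ y) * f y) ≡ f x
    ∑-𝟙-∈ {x} {y ∷ xs} (y∉ ∷ u) x∈ f with x ≟ y | x∈
    ... | no  x≢y  | here x≡y = contradiction x≡y x≢y
    ... | no  _    | there x∈′ = ∑-𝟙-∈ u x∈′ f
    ... | yes refl | _ = begin
      f x + 0 + ∑[ z ∈ xs ] (𝟙 (x ≟ z) * f z)  ≡⟨ cong (f x + 0 +_) (vanish xs y∉) ⟩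
      f x + 0 + 0                              ≡⟨ trans (+-identityʳ _) (+-identityʳ _) ⟩
      f x                                      ∎
      where
      open ≡-Reasoning
      vanish : ∀ zs → All (x ≢_) zs → ∑[ z ∈ zs ] (𝟙 (x ≟ z) * f z) ≡ 0
      vanish []       []         = refl
      vanish (z ∷ zs) (x≢z ∷ x∉) with x ≟ z
      ... | yes x≡z = contradiction x≡z x≢z
      ... | no  _   = vanish zs x∉

∑-swap : {A B : Set} (xs : List A) (ys : List B) (f : A → B → ℕ) →
         ∑[ x ∈ xs ] ∑[ y ∈ ys ] f x y ≡ ∑[ y ∈ ys ] ∑[ x ∈ xs ] f x y
∑-swap []       ys f = sym (trans (∑-const ys 0) (*-zeroʳ (length ys)))
∑-swap (x ∷ xs) ys f =
  trans (cong (∑ ys (f x) +_) (∑-swap xs ys f))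
        (sym (∑-+ ys (f x) (λ y → ∑[ z ∈ xs ] f z y)))

-- With the larger number written as the smaller plus `d`, the two sides differ by `d * d`.
2ab≤a²+b² : ∀ a b → 2 * (a * b) ≤ a * a + b * b
2ab≤a²+b² a b with ≤-total a b
... | inj₁ a≤b = subst (λ b → 2 * (a * b) ≤ a * a + b * b) (m+[n∸m]≡n a≤b) (lemma a _)
  where
  lemma : ∀ a d → 2 * (a * (a + d)) ≤ a * a + (a + d) * (a + d)
  lemma a d = ≤-trans (m≤m+n _ (d * d)) (≤-reflexive (eq a d))
    where
    eq : ∀ a d → 2 * (a * (a + d)) + d * d ≡ a * a + (a + d) * (a + d)
    eq = solve-∀
... | inj₂ b≤a = subst (λ a → 2 * (a * b) ≤ a * a + b * b) (m+[n∸m]≡n b≤a) (lemma b _)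
  where
  lemma : ∀ b d → 2 * ((b + d) * b) ≤ (b + d) * (b + d) + b * b
  lemma b d = ≤-trans (m≤m+n _ (d * d)) (≤-reflexive (eq b d))
    where
    eq : ∀ b d → 2 * ((b + d) * b) + d * d ≡ (b + d) * (b + d) + b * b
    eq = solve-∀

-- The Cauchy–Schwarz inequality, obtained by summing 2 (|xs| f x) F ≤ (|xs| f x)² + F² over x,
-- where F is the sum of f.
∑-cauchy : {A : Set} (xs : List A) (f : A → ℕ) →
           ∑ xs f * ∑ xs f ≤ length xs * ∑[ x ∈ xs ] (f x * f x)
∑-cauchy []             f = z≤n
∑-cauchy xs@(_ ∷ _) f = *-cancelˡ-≤ r (+-cancelʳ-≤ (r * (F * F)) _ _ (begin
  r * (F * F) + r * (F * F)                     ≡⟨ double r F ⟩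
  (2 * (r * F)) * F                             ≡⟨ *-distribˡ-∑ (2 * (r * F)) xs f ⟩
  ∑[ x ∈ xs ] (2 * (r * F) * f x)               ≤⟨ ∑-mono xs (λ {x} _ → amgm (f x)) ⟩
  ∑[ x ∈ xs ] (r * r * (f x * f x) + F * F)     ≡⟨ ∑-+ xs (λ x → r * r * (f x * f x)) (λ _ → F * F) ⟩
  ∑[ x ∈ xs ] (r * r * (f x * f x)) + ∑[ _ ∈ xs ] (F * F)
                                                ≡⟨ cong₂ _+_ (sym (*-distribˡ-∑ (r * r) xs (λ x → f x * f x))) (∑-const xs (F * F)) ⟩
  r * r * Q + r * (F * F)                       ≡⟨ cong (_+ r * (F * F)) (*-assoc r r Q) ⟩
  r * (r * Q) + r * (F * F)                     ∎))
  where
  open ≤-Reasoning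
  r = length xs
  F = ∑ xs f
  Q = ∑[ x ∈ xs ] (f x * f x)
  double : ∀ r F → r * (F * F) + r * (F * F) ≡ (2 * (r * F)) * F
  double = solve-∀
  amgm : ∀ y → 2 * (r * F) * y ≤ r * r * (y * y) + F * F
  amgm y = begin
    2 * (r * F) * y              ≡⟨ eq₁ r F y ⟩
    2 * ((r * y) * F)            ≤⟨ 2ab≤a²+b² (r * y) F ⟩
    r * y * (r * y) + F * F      ≡⟨ eq₂ r F y ⟩
    r * r * (y * y) + F * F      ∎
    where
    eq₁ : ∀ r F y → 2 * (r * F) * y ≡ 2 * ((r * y) * F)
    eq₁ = solve-∀
    eq₂ : ∀ r F y → r * y * (r * y) + F * F ≡ r * r * (y * y) + F * F
    eq₂ = solve-∀

-- Cauchy-Schwarz over the `r` fibres of `f`: their sizes add up to `length T`, and the squares of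
-- the sizes count the colliding ordered pairs.
collisions-≥ : ∀ {X : Set} {r} (f : X → Fin r) (T : List X) →
               length T * length T ≤ r * ∑[ x ∈ T ] ∑[ y ∈ T ] 𝟙 (f x Fin.≟ f y)
collisions-≥ {r = r} f T = begin
  length T * length T                              ≡⟨ cong₂ _*_ total total ⟨
  ∑ (allFin r) fibre * ∑ (allFin r) fibre          ≤⟨ ∑-cauchy (allFin r) fibre ⟩
  length (allFin r) * ∑[ c ∈ allFin r ] (fibre c * fibre c)
                                                   ≡⟨ cong₂ _*_ (length-tabulate {n = r} id) squares ⟩
  r * ∑[ x ∈ T ] ∑[ y ∈ T ] 𝟙 (f x Fin.≟ f y)      ∎
  where
  open ≤-Reasoning
  fibre : Fin r → ℕ
  fibre c = ∑[ y ∈ T ] 𝟙 (f y Fin.≟ c)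
  pick : ∀ c (g : Fin r → ℕ) → ∑[ d ∈ allFin r ] (𝟙 (c Fin.≟ d) * g d) ≡ g c
  pick c g = ∑-𝟙-∈ Fin._≟_ (allFin⁺ r) (∈-allFin c) g
  total : ∑ (allFin r) fibre ≡ length T
  total = begin-equality
    ∑ (allFin r) fibre                                      ≡⟨ ∑-swap (allFin r) T _ ⟩
    ∑[ y ∈ T ] ∑[ c ∈ allFin r ] 𝟙 (f y Fin.≟ c)            ≡⟨ ∑-cong T one ⟩
    ∑[ _ ∈ T ] 1                                            ≡⟨ trans (∑-const T 1) (*-identityʳ _) ⟩
    length T                                                ∎
    where
    one : ∀ y → ∑[ c ∈ allFin r ] 𝟙 (f y Fin.≟ c) ≡ 1
    one y = trans (∑-cong (allFin r) (λ c → sym (*-identityʳ _))) (pick (f y) (λ _ → 1))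
  squares : ∑[ c ∈ allFin r ] (fibre c * fibre c) ≡ ∑[ x ∈ T ] ∑[ y ∈ T ] 𝟙 (f x Fin.≟ f y)
  squares = begin-equality
    ∑[ c ∈ allFin r ] (fibre c * fibre c)
      ≡⟨ ∑-cong (allFin r) (λ c → trans (*-distribˡ-∑ (fibre c) T _) (∑-cong T (λ x → *-comm (fibre c) _))) ⟩
    ∑[ c ∈ allFin r ] ∑[ x ∈ T ] (𝟙 (f x Fin.≟ c) * fibre c)
      ≡⟨ ∑-swap (allFin r) T _ ⟩
    ∑[ x ∈ T ] ∑[ c ∈ allFin r ] (𝟙 (f x Fin.≟ c) * fibre c)
      ≡⟨ ∑-cong T (λ x → pick (f x) fibre) ⟩
    ∑[ x ∈ T ] ∑[ y ∈ T ] 𝟙 (f y Fin.≟ f x)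
      ≡⟨ ∑-swap T T _ ⟩
    ∑[ x ∈ T ] ∑[ y ∈ T ] 𝟙 (f x Fin.≟ f y)  ∎

-- Counting set families: mem presents the elements of B as sets of elements of X

module Family {X B : Set} (_≟_ : DecidableEquality X) (mem : B → X → Bool)
              (ext : ∀ A A′ → (∀ x → mem A x ≡ mem A′ x) → A ≡ A′) where

  _∈ˢ_ : X → B → Set
  x ∈ˢ A = mem A x ≡ true

  _∈ˢ?_ : ∀ x A → Dec (x ∈ˢ A)
  x ∈ˢ? A = mem A x Bool.≟ true

  Containing Avoiding : X → List B → List B
  Containing x = filter (x ∈ˢ?_)
  Avoiding   x = filter (¬? ∘ (x ∈ˢ?_))

  -- `T` is the list of undecided elements: branching has already settled all others in the same way
  -- for every set in `L`.
  AgreeOff : List X → List B → Set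
  AgreeOff T L = ∀ {A A′} → A ∈ L → A′ ∈ L → ∀ {x} → x ∉ T → mem A x ≡ mem A′ x

  length-branch : ∀ x L → length L ≡ length (Containing x L) + length (Avoiding x L)
  length-branch x L = sym (length-filter-split (x ∈ˢ?_) L)

  -- Every element dropped from `T` is either `x`, present in both sets, or excluded from both by
  -- the presence of `x`. This covers dropping `x` alone as well as dropping its neighbours.
  agreeOff-containing : ∀ {x T T′ L} → AgreeOff T L →
    (∀ {A y} → A ∈ L → x ∈ˢ A → y ∈ T → y ≢ x → y ∉ T′ → mem A y ≡ false) →
    AgreeOff T′ (Containing x L)
  agreeOff-containing {x} {T} {T′} {L} agree absent {A} {A′} A∈ A′∈ {y} y∉T′ =
    let A∈L , x∈A = ∈-filter⁻ (x ∈ˢ?_) A∈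
        A′∈L , x∈A′ = ∈-filter⁻ (x ∈ˢ?_) A′∈
    in go A∈L x∈A A′∈L x∈A′
    where
    open import Data.List.Membership.DecPropositional _≟_ using (_∈?_)
    go : A ∈ L → x ∈ˢ A → A′ ∈ L → x ∈ˢ A′ → mem A y ≡ mem A′ y
    go A∈L x∈A A′∈L x∈A′ with y ≟ x | y ∈? T
    ... | yes refl | _       = trans x∈A (sym x∈A′)
    ... | no _     | no y∉T  = agree A∈L A′∈L y∉T
    ... | no y≢x   | yes y∈T =
      trans (absent A∈L x∈A y∈T y≢x y∉T′) (sym (absent A′∈L x∈A′ y∈T y≢x y∉T′))

  agreeOff-avoiding : ∀ {x T T′ L} → AgreeOff T L → (∀ {y} → y ∈ T → y ≢ x → y ∈ T′) →
                      AgreeOff T′ (Avoiding x L)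
  agreeOff-avoiding {x} {T} {T′} {L} agree T⊆ {A} {A′} A∈ A′∈ {y} y∉T′ with y ≟ x
  ... | yes refl = trans (absent A∈) (sym (absent A′∈))
    where
    absent : ∀ {A} → A ∈ Avoiding x L → mem A x ≡ false
    absent A∈ = Bool.¬-not (proj₂ (∈-filter⁻ (¬? ∘ (x ∈ˢ?_)) {xs = L} A∈))
  ... | no y≢x = agree (proj₁ (∈-filter⁻ (¬? ∘ (x ∈ˢ?_)) A∈)) (proj₁ (∈-filter⁻ (¬? ∘ (x ∈ˢ?_)) A′∈))
                       (λ y∈T → y∉T′ (T⊆ y∈T y≢x))

  length-≤1 : ∀ L → Unique L → AgreeOff [] L → length L ≤ 1
  length-≤1 []          _ _ = z≤n
  length-≤1 (_ ∷ [])    _ _ = ≤-refl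
  length-≤1 (A ∷ A′ ∷ L) ((A≢A′ ∷ _) ∷ _) agree =
    contradiction (ext A A′ (λ x → agree (here refl) (there (here refl)) (λ ()))) A≢A′

  agreeOff-tail-containing : ∀ {x T L} → AgreeOff (x ∷ T) L → AgreeOff T (Containing x L)
  agreeOff-tail-containing agree = agreeOff-containing agree λ where
    _ _ (here y≡x)  y≢x _   → contradiction y≡x y≢x
    _ _ (there y∈T) _   y∉T → contradiction y∈T y∉T

  agreeOff-tail-avoiding : ∀ {x T L} → AgreeOff (x ∷ T) L → AgreeOff T (Avoiding x L)
  agreeOff-tail-avoiding agree = agreeOff-avoiding agree λ where
    (here y≡x)  y≢x → contradiction y≡x y≢x
    (there y∈T) _   → y∈T

  length-≤2^ : ∀ T L → Unique L → AgreeOff T L → length L ≤ 2 ^ length T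
  length-≤2^ []      L u agree = length-≤1 L u agree
  length-≤2^ (x ∷ T) L u agree = begin
    length L                                         ≡⟨ length-branch x L ⟩
    length (Containing x L) + length (Avoiding x L)
      ≤⟨ +-mono-≤ (length-≤2^ T _ (filter⁺ _ u) (agreeOff-tail-containing agree))
                  (length-≤2^ T _ (filter⁺ _ u) (agreeOff-tail-avoiding agree)) ⟩
    2 ^ length T + 2 ^ length T                      ≡⟨ cong (2 ^ length T +_) (+-identityʳ _) ⟨
    2 ^ suc (length T)                               ∎
    where open ≤-Reasoning

  -- Closes the recursion f(n+1, j+1) ≤ f(n+1, j) + f(n, j+1) with f(n, j) = n^j K. Selecting an
  -- element lowers the exponent and rejecting it lowers the base.
  pascal-≤ : ∀ n j K → suc n ^ j * K + n ^ suc j * K ≤ suc n ^ suc j * K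
  pascal-≤ n j K = begin
    suc n ^ j * K + n * n ^ j * K      ≤⟨ +-monoʳ-≤ _ (*-monoˡ-≤ K (*-monoʳ-≤ n (^-monoˡ-≤ j (n≤1+n n)))) ⟩
    suc n ^ j * K + n * suc n ^ j * K  ≡⟨ *-distribʳ-+ K (suc n ^ j) (n * suc n ^ j) ⟨
    suc n * suc n ^ j * K              ∎
    where open ≤-Reasoning

  -- The Kleitman–Winston recursion: branch on a vertex x of high degree.  Sets avoiding x lose one
  -- vertex of T, sets containing x lose a proportion 1/(1+c) of T, which happens at most p times.
  module Independent {_~_ : X → X → Set} (_~?_ : ∀ x y → Dec (x ~ y)) (V : X → Set) (m c : ℕ)
    (dense : ∀ T → Unique T → (∀ {x} → x ∈ T → V x) → m < length T →
             ∃ λ x → x ∈ T × length T ≤ suc c * length (filter (x ~?_) T)) where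

    IndependentOn : List X → B → Set
    IndependentOn T A = ∀ {x y} → x ∈ T → y ∈ T → x ∈ˢ A → y ∈ˢ A → ¬ (x ~ y)

    -- Deleting the neighbours leaves at most the fraction c/(c+1) of `T`, which pays for one power
    -- in the invariant |T| c^p ≤ m (c+1)^p.
    shrink : ∀ {x} T p → length T ≤ suc c * length (filter (x ~?_) T) →
             length T * c ^ suc p ≤ m * suc c ^ suc p →
             length (filter (¬? ∘ (x ~?_)) T) * c ^ p ≤ m * suc c ^ p
    shrink {x} T p deg h = *-cancelˡ-≤ (suc c) (begin
      suc c * (n′ * c ^ p)   ≡⟨ *-assoc (suc c) n′ (c ^ p) ⟨
      suc c * n′ * c ^ p     ≤⟨ *-monoˡ-≤ (c ^ p) n′≤ ⟩
      n * c * c ^ p          ≡⟨ *-assoc n c (c ^ p) ⟩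
      n * c ^ suc p          ≤⟨ h ⟩
      m * (suc c * suc c ^ p) ≡⟨ eq m (suc c) (suc c ^ p) ⟩
      suc c * (m * suc c ^ p) ∎)
      where
      open ≤-Reasoning
      n = length T
      d = length (filter (x ~?_) T)
      n′ = length (filter (¬? ∘ (x ~?_)) T)
      eq : ∀ a b c → a * (b * c) ≡ b * (a * c)
      eq = solve-∀
      n′≤ : suc c * n′ ≤ n * c
      n′≤ = +-cancelˡ-≤ n _ _ (begin
        n + suc c * n′          ≤⟨ +-monoˡ-≤ _ deg ⟩
        suc c * d + suc c * n′  ≡⟨ *-distribˡ-+ (suc c) d n′ ⟨
        suc c * (d + n′)        ≡⟨ cong (suc c *_) (length-filter-split (x ~?_) T) ⟩
        suc c * n               ≡⟨ cong (n +_) (*-comm c n) ⟩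
        n + n * c               ∎)

    count : ∀ n p T L → length T ≤ n → length T * c ^ p ≤ m * suc c ^ p →
            Unique T → (∀ {x} → x ∈ T → V x) → Unique L → AgreeOff T L →
            (∀ {A} → A ∈ L → IndependentOn T A) →
            length L ≤ suc n ^ p * 2 ^ m
    count n p T L |T|≤n h uT V-T uL agree indep with length T ≤? m
    ... | yes |T|≤m = begin
      length L             ≤⟨ length-≤2^ T L uL agree ⟩
      2 ^ length T         ≤⟨ ^-monoʳ-≤ 2 |T|≤m ⟩
      2 ^ m                ≤⟨ m≤n*m (2 ^ m) (suc n ^ p) {{m^n≢0 (suc n) p}} ⟩
      suc n ^ p * 2 ^ m    ∎
      where open ≤-Reasoning
    -- With no selections left the invariant reads |T| ≤ m, so this case was settled above.
    count n zero T L |T|≤n h uT V-T uL agree indep | no |T|≰m =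
      contradiction (subst₂ _≤_ (*-identityʳ _) (*-identityʳ m) h) |T|≰m
    count zero (suc p) T L |T|≤n h uT V-T uL agree indep | no |T|≰m =
      contradiction (≤-trans |T|≤n z≤n) |T|≰m
    count (suc n) (suc p) T L |T|≤n h uT V-T uL agree indep | no |T|≰m
      with x , x∈T , deg ← dense T uT V-T (≰⇒> |T|≰m) = begin
      length L                                         ≡⟨ length-branch x L ⟩
      length (Containing x L) + length (Avoiding x L)  ≤⟨ +-mono-≤ containing avoiding ⟩
      suc (suc n) ^ p * 2 ^ m + suc n ^ suc p * 2 ^ m  ≤⟨ pascal-≤ (suc n) p (2 ^ m) ⟩
      suc (suc n) ^ suc p * 2 ^ m                      ∎
      where
      open ≤-Reasoning
      ¬~? = λ y → ¬? (x ~? y)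
      ≢x? = λ y → ¬? (y ≟ x)
      -- `x` itself stays in `T₁` unless it is its own neighbour, so in this branch the recursion
      -- decreases in `p` and keeps the bound on the length.
      T₁ = filter ¬~? T
      T₂ = filter ≢x? T
      T₁⊆ : ∀ {y} → y ∈ T₁ → y ∈ T
      T₁⊆ = proj₁ ∘ ∈-filter⁻ ¬~?
      T₂⊆ : ∀ {y} → y ∈ T₂ → y ∈ T
      T₂⊆ = proj₁ ∘ ∈-filter⁻ ≢x?
      |T₂|<|T| : length T₂ < length T
      |T₂|<|T| = filter-notAll ≢x? T (lose x∈T (λ x≢x → x≢x refl))
      absent : ∀ {A y} → A ∈ L → x ∈ˢ A → y ∈ T → y ≢ x → y ∉ T₁ → mem A y ≡ false
      absent {A} {y} A∈L x∈A y∈T y≢x y∉T₁ = Bool.¬-not λ y∈A →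
        y∉T₁ (∈-filter⁺ ¬~? y∈T (indep A∈L x∈T y∈T x∈A y∈A))
      containing : length (Containing x L) ≤ suc (suc n) ^ p * 2 ^ m
      containing = count (suc n) p T₁ (Containing x L)
        (≤-trans (length-filter ¬~? T) |T|≤n) (shrink T p deg h)
        (filter⁺ _ uT) (V-T ∘ T₁⊆) (filter⁺ _ uL) (agreeOff-containing agree absent)
        (λ A∈ y∈ z∈ → indep (proj₁ (∈-filter⁻ (x ∈ˢ?_) A∈)) (T₁⊆ y∈) (T₁⊆ z∈))
      avoiding : length (Avoiding x L) ≤ suc n ^ suc p * 2 ^ m
      avoiding = count n (suc p) T₂ (Avoiding x L)
        (s≤s⁻¹ (≤-trans |T₂|<|T| |T|≤n)) (≤-trans (*-monoˡ-≤ (c ^ suc p) (<⇒≤ |T₂|<|T|)) h)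
        (filter⁺ _ uT) (V-T ∘ T₂⊆) (filter⁺ _ uL)
        (agreeOff-avoiding agree (∈-filter⁺ ≢x?))
        (λ A∈ y∈ z∈ → indep (proj₁ (∈-filter⁻ (¬? ∘ (x ∈ˢ?_)) A∈)) (T₂⊆ y∈) (T₂⊆ z∈))

  -- The sets are sorted by their first s points S; those with fewer points are pinned down
  -- when T is exhausted.
  module Fingerprint (Good : B → Set) (N s K : ℕ) (1≤K : 1 ≤ K)
    (fixed : ∀ S T L → length S ≡ s → length T ≤ N → Unique S → Unique T →
             (∀ {x} → x ∈ T → x ∉ S) → Unique L → AgreeOff T L →
             (∀ {A} → A ∈ L → Good A × (∀ {x} → x ∈ S → x ∈ˢ A)) → length L ≤ K) where

    count : ∀ j S T L → length S + j ≡ s → length T ≤ N → Unique S → Unique T →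
            (∀ {x} → x ∈ T → x ∉ S) → Unique L → AgreeOff T L →
            (∀ {A} → A ∈ L → Good A × (∀ {x} → x ∈ S → x ∈ˢ A)) →
            length L ≤ suc (length T) ^ j * K
    count zero S T L |S| |T| uS uT dis uL agree good = ≤-trans
      (fixed S T L (trans (sym (+-identityʳ _)) |S|) |T| uS uT dis uL agree good)
      (≤-reflexive (sym (+-identityʳ K)))
    count (suc j) S [] L |S| |T| uS uT dis uL agree good = begin
      length L          ≤⟨ length-≤1 L uL agree ⟩
      1                 ≤⟨ 1≤K ⟩
      K                 ≡⟨ trans (cong (_* K) (^-zeroˡ (suc j))) (+-identityʳ K) ⟨
      1 ^ suc j * K     ∎
      where open ≤-Reasoning
    count (suc j) S (x ∷ T) L |S| |T| uS (x∉T ∷ uT) dis uL agree good = begin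
      length L                                         ≡⟨ length-branch x L ⟩
      length (Containing x L) + length (Avoiding x L)  ≤⟨ +-mono-≤ containing avoiding ⟩
      n ^ j * K + n ^ suc j * K                        ≤⟨ +-monoˡ-≤ _ (*-monoˡ-≤ K (^-monoˡ-≤ j (n≤1+n n))) ⟩
      suc n ^ j * K + n ^ suc j * K                    ≤⟨ pascal-≤ n j K ⟩
      suc n ^ suc j * K                                ∎
      where
      open ≤-Reasoning
      n = suc (length T)
      disjoint : ∀ {y} → y ∈ T → y ∉ x ∷ S
      disjoint y∈T (here refl)  = All.lookup x∉T y∈T refl
      disjoint y∈T (there y∈S) = dis (there y∈T) y∈S
      x∉S : All (x ≢_) S
      x∉S = All.tabulate λ { y∈S refl → dis (here refl) y∈S }
      containing : length (Containing x L) ≤ n ^ j * K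
      containing = count j (x ∷ S) T (Containing x L) (trans (sym (+-suc _ j)) |S|)
        (≤-trans (n≤1+n _) |T|) (x∉S ∷ uS) uT disjoint (filter⁺ _ uL)
        (agreeOff-tail-containing agree) good′
        where
        good′ : ∀ {A} → A ∈ Containing x L → Good A × (∀ {y} → y ∈ x ∷ S → y ∈ˢ A)
        good′ A∈ with A∈L , x∈A ← ∈-filter⁻ (x ∈ˢ?_) A∈ =
          proj₁ (good A∈L) , λ { (here refl) → x∈A ; (there y∈S) → proj₂ (good A∈L) y∈S }
      avoiding : length (Avoiding x L) ≤ n ^ suc j * K
      avoiding = count (suc j) S T (Avoiding x L) |S| (≤-trans (n≤1+n _) |T|) uS uT
        (dis ∘ there) (filter⁺ _ uL) (agreeOff-tail-avoiding agree)
        (good ∘ proj₁ ∘ ∈-filter⁻ (¬? ∘ (x ∈ˢ?_)))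

-- Many pairs on common lines with a small arc

module Density {X : Set} (_≟_ : DecidableEquality X) {r : ℕ} (dir : X → X → Fin r) (S : List X) where

  _~_ : X → X → Set
  x ~ y = x ≢ y × Any (λ v → dir v x ≡ dir v y) S

  _~?_ : ∀ x y → Dec (x ~ y)
  x ~? y = ¬? (x ≟ y) ×-dec any? (λ v → dir v x Fin.≟ dir v y) S

  AtMostTwo : Set
  AtMostTwo = ∀ {x y} → x ∉ S → y ∉ S → x ≢ y → ∀ {v₁ v₂ v₃} → v₁ ∈ S → v₂ ∈ S → v₃ ∈ S →
              v₁ ≢ v₂ → v₁ ≢ v₃ → v₂ ≢ v₃ →
              dir v₁ x ≡ dir v₁ y → dir v₂ x ≡ dir v₂ y → dir v₃ x ≡ dir v₃ y → ⊥

  module _ (uS : Unique S) (atMostTwo : AtMostTwo) where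

    -- The diagonal gets the trivial bound `length S`. Off the diagonal a positive count means
    -- adjacency, and then `atMostTwo` limits it to 2.
    multiplicity : ∀ {x y} → x ∉ S → y ∉ S →
      ∑[ v ∈ S ] 𝟙 (dir v x Fin.≟ dir v y) ≤ 𝟙 (x ≟ y) * length S + 2 * 𝟙 (x ~? y)
    multiplicity {x} {y} x∉S y∉S rewrite ∑-𝟙 (λ v → dir v x Fin.≟ dir v y) S
      with x ≟ y
    ... | yes _ = ≤-trans (length-filter _ S) (≤-trans (m≤m+n _ 0) (m≤m+n _ _))
    ... | no x≢y with any? (λ v → dir v x Fin.≟ dir v y) S
    ...   | yes _ = few (filter⁺ same? uS) (λ v∈ → ∈-filter⁻ same? v∈)
      where
      same? = λ v → dir v x Fin.≟ dir v y
      few : ∀ {W} → Unique W → (∀ {v} → v ∈ W → v ∈ S × dir v x ≡ dir v y) → length W ≤ 2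
      few {[]}              _ _ = z≤n
      few {_ ∷ []}          _ _ = s≤s z≤n
      few {_ ∷ _ ∷ []}      _ _ = ≤-refl
      few {_ ∷ _ ∷ _ ∷ _} ((a≢b ∷ a≢c ∷ _) ∷ (b≢c ∷ _) ∷ _) W⊆
        with a∈S , a-eq ← W⊆ (here refl) | b∈S , b-eq ← W⊆ (there (here refl))
           | c∈S , c-eq ← W⊆ (there (there (here refl))) =
        ⊥-elim (atMostTwo x∉S y∉S x≢y a∈S b∈S c∈S a≢b a≢c b≢c a-eq b-eq c-eq)
    ...   | no none = ≤-reflexive (cong length (filter-none _ (All.tabulate λ v∈S eq → none (lose v∈S eq))))

    module _ (T : List X) (uT : Unique T) (T∩S : ∀ {x} → x ∈ T → x ∉ S) where

      degree : X → ℕ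
      degree x = ∑[ y ∈ T ] 𝟙 (x ~? y)

      -- Double counting of the triples (v, x, y) with `dir v x ≡ dir v y`: from below by
      -- `collisions-≥` for each `v`, from above by `multiplicity` for each pair.
      degree-sum-≥ : length S * (length T * length T) ≤ r * (length T * length S + 2 * ∑ T degree)
      degree-sum-≥ = begin
        length S * (length T * length T)
          ≡⟨ ∑-const S _ ⟨
        ∑[ v ∈ S ] (length T * length T)
          ≤⟨ ∑-mono S (λ {v} _ → collisions-≥ (dir v) T) ⟩
        ∑[ v ∈ S ] (r * ∑[ x ∈ T ] ∑[ y ∈ T ] 𝟙 (dir v x Fin.≟ dir v y))
          ≡⟨ *-distribˡ-∑ r S _ ⟨
        r * ∑[ v ∈ S ] ∑[ x ∈ T ] ∑[ y ∈ T ] 𝟙 (dir v x Fin.≟ dir v y)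
          ≡⟨ cong (r *_) (trans (∑-swap S T _) (∑-cong T (λ x → ∑-swap S T _))) ⟩
        r * ∑[ x ∈ T ] ∑[ y ∈ T ] ∑[ v ∈ S ] 𝟙 (dir v x Fin.≟ dir v y)
          ≤⟨ *-monoʳ-≤ r (∑-mono T λ x∈T → ∑-mono T λ y∈T → multiplicity (T∩S x∈T) (T∩S y∈T)) ⟩
        r * ∑[ x ∈ T ] ∑[ y ∈ T ] (𝟙 (x ≟ y) * length S + 2 * 𝟙 (x ~? y))
          ≤⟨ *-monoʳ-≤ r (∑-mono T λ x∈T → ≤-reflexive (row x∈T)) ⟩
        r * ∑[ x ∈ T ] (length S + 2 * degree x)
          ≡⟨ cong (r *_) (∑-+ T (λ _ → length S) (λ x → 2 * degree x)) ⟩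
        r * (∑[ _ ∈ T ] length S + ∑[ x ∈ T ] (2 * degree x))
          ≡⟨ cong (r *_) (cong₂ _+_ (∑-const T _) (sym (*-distribˡ-∑ 2 T degree))) ⟩
        r * (length T * length S + 2 * ∑ T degree)  ∎
        where
        open ≤-Reasoning
        row : ∀ {x} → x ∈ T → ∑[ y ∈ T ] (𝟙 (x ≟ y) * length S + 2 * 𝟙 (x ~? y)) ≡ length S + 2 * degree x
        row {x} x∈T = trans (∑-+ T (λ y → 𝟙 (x ≟ y) * length S) (λ y → 2 * 𝟙 (x ~? y)))
          (cong₂ _+_ (∑-𝟙-∈ _≟_ uT x∈T (λ _ → length S)) (sym (*-distribˡ-∑ 2 T (λ y → 𝟙 (x ~? y)))))

      -- As `t` is at least r/w, n > r + t gives (w+1) r ≤ w n. After multiplication of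
      -- `degree-sum-≥` by w+1, the diagonal term is therefore at most w n² s, which cancels against
      -- the left side. What remains is n² ≤ (c+1) E, so the average degree is at least n/(c+1).
      dense : ∀ {w t c} → r ≤ w * t → 2 * (r * suc w) ≤ suc c * length S → 1 ≤ length S →
              r + t < length T → ∃ λ x → x ∈ T × length T ≤ suc c * length (filter (x ~?_) T)
      dense {w} {t} {c} r≤wt 2rw≤cs 1≤s r+t<n with s@(suc _) ← length S | E ← ∑ T degree in E≡
        | sum≥ ← degree-sum-≥ =
        let x , x∈T , le = find (∑-pigeonhole n T (λ x → suc c * degree x) (≤-<-trans z≤n r+t<n) n²≤)
        in x , x∈T , subst (λ d → n ≤ suc c * d) (∑-𝟙 (x ~?_) T) le
        where
        open ≤-Reasoning
        n = length T
        wr≤wn : suc w * r ≤ w * n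
        wr≤wn = begin
          r + w * r       ≤⟨ +-monoˡ-≤ (w * r) r≤wt ⟩
          w * t + w * r   ≡⟨ trans (+-comm (w * t) _) (sym (*-distribˡ-+ w r t)) ⟩
          w * (r + t)     ≤⟨ *-monoʳ-≤ w (<⇒≤ r+t<n) ⟩
          w * n           ∎
        scaled : s * (n * n) ≤ s * (suc c * E)
        scaled = +-cancelˡ-≤ (w * n * (n * s)) _ _ (begin
          w * n * (n * s) + s * (n * n)                 ≡⟨ eq₁ w n s ⟩
          suc w * (s * (n * n))                         ≤⟨ *-monoʳ-≤ (suc w) sum≥ ⟩
          suc w * (r * (n * s + 2 * E))                 ≡⟨ eq₂ (suc w) r (n * s) E ⟩
          suc w * r * (n * s) + 2 * (r * suc w) * E     ≤⟨ +-mono-≤ (*-monoˡ-≤ (n * s) wr≤wn) (*-monoˡ-≤ E 2rw≤cs) ⟩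
          w * n * (n * s) + suc c * s * E               ≡⟨ cong (w * n * (n * s) +_) (eq₃ (suc c) s E) ⟩
          w * n * (n * s) + s * (suc c * E)             ∎)
          where
          eq₁ : ∀ w n s → w * n * (n * s) + s * (n * n) ≡ suc w * (s * (n * n))
          eq₁ = solve-∀
          eq₂ : ∀ w r x E → w * (r * (x + 2 * E)) ≡ w * r * x + 2 * (r * w) * E
          eq₂ = solve-∀
          eq₃ : ∀ c s E → c * s * E ≡ s * (c * E)
          eq₃ = solve-∀
        n²≤ : n * n ≤ ∑[ x ∈ T ] (suc c * degree x)
        n²≤ = begin
          n * n                             ≤⟨ *-cancelˡ-≤ s scaled ⟩
          suc c * E                         ≡⟨ cong (suc c *_) E≡ ⟨
          suc c * ∑ T degree                ≡⟨ *-distribˡ-∑ (suc c) T degree ⟩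
          ∑[ x ∈ T ] (suc c * degree x)     ∎

-- The recursive bound for arcs

module Arcs {q : ℕ} (F : FiniteField q) where
  open Directions F

  mem : PointSet q → Point q → Bool
  mem A (i , j) = lookup (lookup A i) j

  mem-ext : ∀ A A′ → (∀ x → mem A x ≡ mem A′ x) → A ≡ A′
  mem-ext A A′ eq = Pointwise-≡⇒≡ (ext λ i → Pointwise-≡⇒≡ (ext λ j → eq (i , j)))

  open Family _≟ₚ_ mem mem-ext

  points : List (Point q)
  points = cartesianProduct (allFin q) (allFin q)

  ∈-points : ∀ x → x ∈ points
  ∈-points (i , j) = ∈-cartesianProduct⁺ (∈-allFin i) (∈-allFin j)

  length-points : length points ≡ q * q
  length-points = trans (length-product (allFin q) (allFin q))
    (cong₂ _*_ (length-tabulate {n = q} id) (length-tabulate {n = q} id))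
    where
    length-product : ∀ {A B : Set} (xs : List A) (ys : List B) →
                     length (cartesianProduct xs ys) ≡ length xs * length ys
    length-product []       ys = refl
    length-product (x ∷ xs) ys = trans (length-++ (map (x ,_) ys))
      (cong₂ _+_ (length-map (x ,_) ys) (length-product xs ys))

  module _ {s w t c p : ℕ} (1≤s : 1 ≤ s) (q<wt : suc q ≤ w * t) (2qw≤cs : 2 * (suc q * suc w) ≤ suc c * s)
           (q²c^p≤ : q * q * c ^ p ≤ (suc q + t) * suc c ^ p) where

    count-fixed : ∀ S T L → length S ≡ s → length T ≤ q * q → Unique S → Unique T →
      (∀ {x} → x ∈ T → x ∉ S) → Unique L → AgreeOff T L →
      (∀ {A} → A ∈ L → IsArc F A × (∀ {x} → x ∈ S → x ∈ˢ A)) →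
      length L ≤ suc (q * q) ^ p * 2 ^ (suc q + t)
    count-fixed S T []          _ _ _ _ _ _ _ _ = z≤n
    -- `S` inherits the arc property from any member of `L`, here `A₀`; this is why the empty list
    -- is treated apart.
    count-fixed S T L@(A₀ ∷ _) refl |T|≤q² uS uT T∩S uL agree arcs =
      Independent.count _~?_ (_∉ S) (suc q + t) c
        (λ T uT T∩S → dense uS atMostTwo T uT T∩S {w} {t} {c} q<wt 2qw≤cs 1≤s)
        (q * q) p T L |T|≤q² (≤-trans (*-monoˡ-≤ (c ^ p) |T|≤q²) q²c^p≤) uT T∩S uL agree independent
      where
      open Density _≟ₚ_ dir S
      atMostTwo : AtMostTwo
      atMostTwo _ _ x≢y v₁∈ v₂∈ v₃∈ v₁≢v₂ v₁≢v₃ v₂≢v₃ eq₁ eq₂ eq₃ =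
        let arc , S⊆A₀ = arcs (here refl)
        in arc _ _ _ (S⊆A₀ v₁∈) (S⊆A₀ v₂∈) (S⊆A₀ v₃∈) v₁≢v₂ v₁≢v₃ v₂≢v₃ (three-on-line x≢y eq₁ eq₂ eq₃)
      independent : ∀ {A} → A ∈ L → ∀ {x y} → x ∈ T → y ∈ T → x ∈ˢ A → y ∈ˢ A → ¬ (x ~ y)
      independent A∈L {x} {y} x∈T y∈T x∈A y∈A (x≢y , meets) =
        let arc , S⊆A = arcs A∈L
            v , v∈S , eq = find meets
        in arc v x y (S⊆A v∈S) x∈A y∈A
             (λ v≡x → T∩S x∈T (subst (_∈ S) v≡x v∈S)) (λ v≡y → T∩S y∈T (subst (_∈ S) v≡y v∈S)) x≢y (dir-collinear v x y eq)

    -- The three factors pay for the `s` points of the fingerprint, the at most `p` selected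
    -- vertices, and the subsets of the remaining candidates.
    count-arcs : ∀ L → Unique L → All (IsArc F) L →
                 length L ≤ suc (q * q) ^ s * (suc (q * q) ^ p * 2 ^ (suc q + t))
    count-arcs L uL arcs =
      subst (λ n → length L ≤ suc n ^ s * (suc (q * q) ^ p * 2 ^ (suc q + t))) length-points
        (Fingerprint.count (IsArc F) (q * q) s (suc (q * q) ^ p * 2 ^ (suc q + t))
          (*-mono-≤ (m^n>0 (suc (q * q)) p) (m^n>0 2 (suc q + t))) count-fixed
          s [] points L refl (≤-reflexive length-points) []
          (cartesianProduct⁺ (allFin⁺ q) (allFin⁺ q)) (λ _ ()) uL
          (λ _ _ {x} x∉ → contradiction (∈-points x) x∉)
          (λ A∈L → All.lookup arcs A∈L , λ ()))

-- Choice of the parameters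

^-distribʳ-* : ∀ m n o → (m * n) ^ o ≡ m ^ o * n ^ o
^-distribʳ-* m n zero    = refl
^-distribʳ-* m n (suc o) = trans (cong (m * n *_) (^-distribʳ-* m n o)) (interchange m n (m ^ o) (n ^ o))
  where
  interchange : ∀ a b c d → a * b * (c * d) ≡ a * c * (b * d)
  interchange = solve-∀

-- Bernoulli's inequality (1 + 1/c)^n ≥ 1 + n/c with denominators cleared.
bernoulli : ∀ c n → c ^ n * (c + n) ≤ suc c ^ n * c
bernoulli c zero    = ≤-reflexive (cong (_+ 0) (+-identityʳ c))
bernoulli c (suc n) = begin
  c * c ^ n * (c + suc n)      ≤⟨ m≤m+n _ (c ^ n * n) ⟩
  c * c ^ n * (c + suc n) + c ^ n * n
                               ≡⟨ eq c (c ^ n) n ⟩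
  suc c * (c ^ n * (c + n))    ≤⟨ *-monoʳ-≤ (suc c) (bernoulli c n) ⟩
  suc c * (suc c ^ n * c)      ≡⟨ *-assoc (suc c) (suc c ^ n) c ⟨
  suc c * suc c ^ n * c        ∎
  where
  open ≤-Reasoning
  eq : ∀ c x n → c * x * (c + suc n) + x * n ≡ suc c * (x * (c + n))
  eq = solve-∀

-- The case n = c of Bernoulli gives (1 + 1/c)^c ≥ 2, which is raised to the power `J`.
doubling : ∀ c J → 1 ≤ c → 2 ^ J * c ^ (c * J) ≤ suc c ^ (c * J)
doubling c@(suc _) J _ = begin
  2 ^ J * c ^ (c * J)   ≡⟨ cong (2 ^ J *_) (^-*-assoc c c J) ⟨
  2 ^ J * (c ^ c) ^ J   ≡⟨ ^-distribʳ-* 2 (c ^ c) J ⟨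
  (2 * c ^ c) ^ J       ≤⟨ ^-monoˡ-≤ J (*-cancelʳ-≤ _ _ c (≤-trans (≤-reflexive (eq c (c ^ c))) (bernoulli c c))) ⟩
  (suc c ^ c) ^ J       ≡⟨ ^-*-assoc (suc c) c J ⟩
  suc c ^ (c * J)       ∎
  where
  open ≤-Reasoning
  eq : ∀ c x → 2 * x * c ≡ x * (c + c)
  eq = solve-∀

-- Opaque so that products with the large numeral constant (4 ^ 5) 100 are never unfolded.
opaque
  constant : ℕ → ℕ → ℕ
  constant K H = H + 4 * (K * H) + 1 + K

  constant-expand : ∀ K H x → constant K H * x ≡ H * x + 4 * (K * H * x) + x + K * x
  constant-expand = expand
    where
    expand : ∀ K H x → (H + 4 * (K * H) + 1 + K) * x ≡ H * x + 4 * (K * H * x) + x + K * x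
    expand = solve-∀

  1≤constant : ∀ K H → 1 ≤ constant K H
  1≤constant K H = ≤-trans (m≤n+m 1 (H + 4 * (K * H))) (m≤m+n _ K)

-- w stands for q^(1/5) and J for log₂ q, both up to constant factors.
module _ {q : ℕ} (F : FiniteField q) (w J K H : ℕ) (1≤w : 1 ≤ w) (1≤K : 1 ≤ K)
         (q<Kw⁵ : suc q ≤ K * w ^ 5) (q<2^J : suc q ≤ 2 ^ J) (J²≤Hw : J * J ≤ H * w) where

  private
    s t c p : ℕ
    -- The excess `t` is a proportion 1/w of K w⁵. The value of `c` comes from 2(q+1)(w+1) ≤ 4 K w⁶
    -- = c s. Reducing q² candidates to order q takes `J` halvings of `c` selections each, whence
    -- `p`.
    s = w ^ 3
    t = K * w ^ 4
    c = 4 * (K * w ^ 3)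
    p = c * J

    1≤w^ : ∀ n → 1 ≤ w ^ n
    1≤w^ n = subst (_≤ w ^ n) (^-zeroˡ n) (^-monoˡ-≤ n 1≤w)

    q<wt : suc q ≤ w * t
    q<wt = ≤-trans q<Kw⁵ (≤-reflexive (eq K w (w ^ 4)))
      where
      eq : ∀ a b c → a * (b * c) ≡ b * (a * c)
      eq = solve-∀

    2qw≤cs : 2 * (suc q * suc w) ≤ suc c * s
    2qw≤cs = begin
      2 * (suc q * suc w)             ≤⟨ *-monoʳ-≤ 2 (*-mono-≤ q<Kw⁵ (+-monoˡ-≤ w 1≤w)) ⟩
      2 * (K * w ^ 5 * (w + w))       ≡⟨ eq K w ⟩
      c * s                           ≤⟨ m≤n+m (c * s) s ⟩
      suc c * s                       ∎
      where
      open ≤-Reasoning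
      eq : ∀ K w → 2 * (K * (w * (w * (w * (w * (w * 1))))) * (w + w)) ≡
                   4 * (K * (w * (w * (w * 1)))) * (w * (w * (w * 1)))
      eq = solve-∀

    q²c^p≤ : q * q * c ^ p ≤ (suc q + t) * suc c ^ p
    q²c^p≤ = begin
      q * q * c ^ p
        -- One factor q is bounded by `suc q + t`, the other by `2 ^ J`.
        ≤⟨ *-monoˡ-≤ (c ^ p) (*-mono-≤ (≤-trans (n≤1+n q) (m≤m+n (suc q) t)) (≤-trans (n≤1+n q) q<2^J)) ⟩
      (suc q + t) * 2 ^ J * c ^ p    ≡⟨ *-assoc (suc q + t) (2 ^ J) (c ^ p) ⟩
      (suc q + t) * (2 ^ J * c ^ p)
        ≤⟨ *-monoʳ-≤ (suc q + t) (doubling c J (*-mono-≤ {1} {4} (s≤s z≤n) (*-mono-≤ 1≤K (1≤w^ 3)))) ⟩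
      (suc q + t) * suc c ^ p        ∎
      where open ≤-Reasoning

    q²<2^2J : suc (q * q) ≤ 2 ^ (J + J)
    q²<2^2J = begin
      suc (q * q)         ≤⟨ m≤m+n (suc (q * q)) (q + q) ⟩
      suc (q * q) + (q + q) ≡⟨ eq q ⟩
      suc q * suc q       ≤⟨ *-mono-≤ q<2^J q<2^J ⟩
      2 ^ J * 2 ^ J       ≡⟨ ^-distribˡ-+-* 2 J J ⟨
      2 ^ (J + J)         ∎
      where
      open ≤-Reasoning
      eq : ∀ q → suc (q * q) + (q + q) ≡ suc q * suc q
      eq = solve-∀

    -- The selected vertices cost 8 K w³ J² bits, which `J²≤Hw` turns into order w⁴, the same order
    -- as `t`.
    exponent-≤ : (J + J) * s + ((J + J) * p + (suc q + t)) ≤ q + 2 * (constant K H * w ^ 4)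
    exponent-≤ = begin
      (J + J) * s + ((J + J) * p + (suc q + t))
        ≡⟨ eq₁ J s q t K ⟩
      2 * (J * s) + 8 * (K * s * (J * J)) + 1 + t + q
        ≤⟨ +-monoˡ-≤ q (+-monoˡ-≤ t (+-mono-≤ (+-mono-≤ (*-monoʳ-≤ 2 (*-monoˡ-≤ s J≤Hw))
             (*-monoʳ-≤ 8 (*-monoʳ-≤ (K * s) J²≤Hw))) (1≤w^ 4))) ⟩
      2 * (H * w * s) + 8 * (K * s * (H * w)) + w ^ 4 + t + q
        -- Doubling `w ^ 4` and `t` makes all terms besides q even, so that a factor 2 comes out.
        ≤⟨ m≤m+n _ (w ^ 4 + t) ⟩
      2 * (H * w * s) + 8 * (K * s * (H * w)) + w ^ 4 + t + q + (w ^ 4 + t)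
        ≡⟨ eq₂ H K w s q ⟩
      q + 2 * (H * w ^ 4 + 4 * (K * H * w ^ 4) + w ^ 4 + K * w ^ 4)
        ≡⟨ cong (λ e → q + 2 * e) (constant-expand K H (w ^ 4)) ⟨
      q + 2 * (constant K H * w ^ 4)  ∎
      where
      open ≤-Reasoning
      J≤J² : ∀ J → J ≤ J * J
      J≤J² zero    = z≤n
      J≤J² (suc J) = m≤m+n (suc J) _
      J≤Hw : J ≤ H * w
      J≤Hw = ≤-trans (J≤J² J) J²≤Hw
      eq₁ : ∀ J s q t K → (J + J) * s + ((J + J) * (4 * (K * s) * J) + (suc q + t)) ≡
                          2 * (J * s) + 8 * (K * s * (J * J)) + 1 + t + q
      eq₁ = solve-∀
      eq₂ : ∀ H K w s q →
        2 * (H * w * s) + 8 * (K * s * (H * w)) + w * s + K * (w * s) + q + (w * s + K * (w * s)) ≡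
        q + 2 * (H * (w * s) + 4 * (K * H * (w * s)) + w * s + K * (w * s))
      eq₂ = solve-∀

  arcs-≤ : ∀ L → Unique L → All (IsArc F) L → length L ≤ 2 ^ q * 4 ^ (constant K H * w ^ 4)
  arcs-≤ L uL arcs = begin
    length L
      ≤⟨ Arcs.count-arcs F {s} {w} {t} {c} {p} (1≤w^ 3) q<wt 2qw≤cs q²c^p≤ L uL arcs ⟩
    suc (q * q) ^ s * (suc (q * q) ^ p * 2 ^ m)
      ≤⟨ *-mono-≤ (power s) (*-monoˡ-≤ (2 ^ m) (power p)) ⟩
    2 ^ ((J + J) * s) * (2 ^ ((J + J) * p) * 2 ^ m)
      ≡⟨ cong (2 ^ ((J + J) * s) *_) (^-distribˡ-+-* 2 ((J + J) * p) m) ⟨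
    2 ^ ((J + J) * s) * 2 ^ ((J + J) * p + m)
      ≡⟨ ^-distribˡ-+-* 2 ((J + J) * s) ((J + J) * p + m) ⟨
    2 ^ ((J + J) * s + ((J + J) * p + m))
      ≤⟨ ^-monoʳ-≤ 2 exponent-≤ ⟩
    2 ^ (q + 2 * (constant K H * w ^ 4))
      ≡⟨ ^-distribˡ-+-* 2 q (2 * (constant K H * w ^ 4)) ⟩
    2 ^ q * 2 ^ (2 * (constant K H * w ^ 4))
      ≡⟨ cong (2 ^ q *_) (^-*-assoc 2 2 (constant K H * w ^ 4)) ⟨
    2 ^ q * 4 ^ (constant K H * w ^ 4)  ∎
    where
    open ≤-Reasoning
    m = suc q + t
    power : ∀ e → suc (q * q) ^ e ≤ 2 ^ ((J + J) * e)
    power e = ≤-trans (^-monoˡ-≤ e q²<2^2J) (≤-reflexive (^-*-assoc 2 (J + J) e))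

crossing : ∀ (f : ℕ → ℕ) {q} n → f 0 ≤ q → q < f n → ∃ λ k → f k ≤ q × q < f (suc k)
crossing f     zero    f0≤q q<f0 = contradiction f0≤q (<⇒≱ q<f0)
crossing f {q} (suc n) f0≤q q<fn with f n ≤? q
... | yes fn≤q = n , fn≤q , q<fn
... | no  fn≰q = crossing f n f0≤q (≰⇒> fn≰q)

n<2^n : ∀ n → n < 2 ^ n
n<2^n zero    = s≤s z≤n
n<2^n (suc n) = begin-strict
  suc n          ≤⟨ n<2^n n ⟩
  2 ^ n          <⟨ m<m+n (2 ^ n) (m^n>0 2 n) ⟩
  2 ^ n + 2 ^ n  ≡⟨ cong (2 ^ n +_) (+-identityʳ (2 ^ n)) ⟨
  2 ^ suc n      ∎
  where open ≤-Reasoning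

[4^k]⁵≡2^10k : ∀ k → (2 ^ k * 2 ^ k) ^ 5 ≡ 2 ^ (10 * k)
[4^k]⁵≡2^10k k = begin
  (2 ^ k * 2 ^ k) ^ 5  ≡⟨ cong (_^ 5) (^-distribˡ-+-* 2 k k) ⟨
  (2 ^ (k + k)) ^ 5    ≡⟨ ^-*-assoc 2 (k + k) 5 ⟩
  2 ^ ((k + k) * 5)    ≡⟨ cong (2 ^_) (eq k) ⟩
  2 ^ (10 * k)         ∎
  where
  open ≡-Reasoning
  eq : ∀ k → (k + k) * 5 ≡ 10 * k
  eq = solve-∀

C : ℕ
C = constant (4 ^ 5) 100

count-≤ : ∀ {q} → 1 ≤ q → (F : FiniteField q) → ∃ λ w → w ^ 5 ≤ q ×
          (∀ L → Unique L → All (IsArc F) L → length L ≤ 2 ^ q * 4 ^ (C * w ^ 4))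
count-≤ {q} 1≤q F
  -- Here w = 4^k with w⁵ ≤ q < (4w)⁵ = 2^(10(k+1)), whence K = 4⁵ and J = 10(k+1). Taking w to be
  -- the square of 2^k makes k + 1 ≤ 2^k yield J² ≤ 100 w, whence H = 100.
  with k , w⁵≤q , q<w′⁵ ← crossing (λ k → (2 ^ k * 2 ^ k) ^ 5) q 1≤q
         (<-≤-trans (n<2^n q) (≤-trans (^-monoʳ-≤ 2 (m≤m+n q (9 * q))) (≤-reflexive (sym ([4^k]⁵≡2^10k q)))))
  = y * y , w⁵≤q , arcs-≤ F (y * y) (10 * suc k) (4 ^ 5) 100 (*-mono-≤ 1≤y 1≤y) (m^n>0 4 5)
      (≤-trans q<w′⁵ (≤-reflexive (trans (cong (_^ 5) (quadruple y)) (^-distribʳ-* 4 (y * y) 5))))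
      (≤-trans q<w′⁵ (≤-reflexive ([4^k]⁵≡2^10k (suc k))))
      (≤-trans (*-mono-≤ (*-monoʳ-≤ 10 (n<2^n k)) (*-monoʳ-≤ 10 (n<2^n k))) (≤-reflexive (hundred y)))
  where
  y = 2 ^ k
  1≤y : 1 ≤ y
  1≤y = m^n>0 2 k
  quadruple : ∀ y → (2 * y) * (2 * y) ≡ 4 * (y * y)
  quadruple = solve-∀
  hundred : ∀ y → (10 * y) * (10 * y) ≡ 100 * (y * y)
  hundred = solve-∀

-- Rational exponents

-- The second hypothesis says 2^(q + 2u/v) < N after raising to the power `v`; comparison with the
-- upper bound 2^(q + 2E) on N gives the claim.
exponent-from-count : ∀ {q N u v E} → N ≤ 2 ^ q * 4 ^ E → 4 ^ u * 2 ^ (q * v) < N ^ v → u ≤ E * v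
exponent-from-count {q} {N} {u} {v} {E} N≤ lt with u ≤? E * v
... | yes u≤Ev = u≤Ev
... | no  u≰Ev = contradiction lt (≤⇒≯ (begin
  N ^ v                         ≤⟨ ^-monoˡ-≤ v N≤ ⟩
  (2 ^ q * 4 ^ E) ^ v           ≡⟨ ^-distribʳ-* (2 ^ q) (4 ^ E) v ⟩
  (2 ^ q) ^ v * (4 ^ E) ^ v     ≡⟨ cong₂ _*_ (^-*-assoc 2 q v) (^-*-assoc 4 E v) ⟩
  2 ^ (q * v) * 4 ^ (E * v)     ≤⟨ *-monoʳ-≤ (2 ^ (q * v)) (^-monoʳ-≤ 4 (<⇒≤ (≰⇒> u≰Ev))) ⟩
  2 ^ (q * v) * 4 ^ u           ≡⟨ *-comm (2 ^ (q * v)) (4 ^ u) ⟩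
  4 ^ u * 2 ^ (q * v)           ∎))
  where open ≤-Reasoning

-- This is u/v ≤ D w⁴ ≤ q^(a/b) q^(4/5) raised to the power 5b: `D` is at most q^(1/b), hence at
-- most q^(a/b), and w⁴ is at most q^(4/5).
absorb-constant : ∀ D {w q u v} a b → 1 ≤ a → 1 ≤ q → D ^ b ≤ q → w ^ 5 ≤ q → u ≤ D * w ^ 4 * v →
                  u ^ (5 * b) ≤ q ^ (4 * b + 5 * a) * v ^ (5 * b)
absorb-constant D {w} {q} {u} {v} a b 1≤a 1≤q D^b≤q w⁵≤q u≤ = begin
  u ^ (5 * b)                                     ≤⟨ ^-monoˡ-≤ (5 * b) u≤ ⟩
  (D * w ^ 4 * v) ^ (5 * b)                       ≡⟨ ^-distribʳ-* (D * w ^ 4) v (5 * b) ⟩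
  (D * w ^ 4) ^ (5 * b) * v ^ (5 * b)             ≤⟨ *-monoˡ-≤ (v ^ (5 * b)) bound ⟩
  q ^ (4 * b + 5 * a) * v ^ (5 * b)               ∎
  where
  open ≤-Reasoning
  swap : ∀ b → 4 * (5 * b) ≡ 5 * (4 * b)
  swap = solve-∀
  w-part : (w ^ 4) ^ (5 * b) ≤ q ^ (4 * b)
  w-part = begin
    (w ^ 4) ^ (5 * b)   ≡⟨ ^-*-assoc w 4 (5 * b) ⟩
    w ^ (4 * (5 * b))   ≡⟨ cong (w ^_) (swap b) ⟩
    w ^ (5 * (4 * b))   ≡⟨ ^-*-assoc w 5 (4 * b) ⟨
    (w ^ 5) ^ (4 * b)   ≤⟨ ^-monoˡ-≤ (4 * b) w⁵≤q ⟩
    q ^ (4 * b)         ∎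
  D-part : D ^ (5 * b) ≤ q ^ (5 * a)
  D-part = begin
    D ^ (5 * b)   ≡⟨ cong (D ^_) (*-comm 5 b) ⟩
    D ^ (b * 5)   ≡⟨ ^-*-assoc D b 5 ⟨
    (D ^ b) ^ 5   ≤⟨ ^-monoˡ-≤ 5 D^b≤q ⟩
    q ^ 5         ≤⟨ ^-monoʳ-≤ q {{>-nonZero 1≤q}} (*-monoʳ-≤ 5 1≤a) ⟩
    q ^ (5 * a)   ∎
  bound : (D * w ^ 4) ^ (5 * b) ≤ q ^ (4 * b + 5 * a)
  bound = begin
    (D * w ^ 4) ^ (5 * b)             ≡⟨ ^-distribʳ-* D (w ^ 4) (5 * b) ⟩
    D ^ (5 * b) * (w ^ 4) ^ (5 * b)   ≤⟨ *-mono-≤ D-part w-part ⟩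
    q ^ (5 * a) * q ^ (4 * b)         ≡⟨ *-comm (q ^ (5 * a)) (q ^ (4 * b)) ⟩
    q ^ (4 * b) * q ^ (5 * a)         ≡⟨ ^-distribˡ-+-* q (4 * b) (5 * a) ⟨
    q ^ (4 * b + 5 * a)               ∎

-- Here δ = a/b, and a smaller positive rational serves for a real δ. Every rational u/v with 2^(q +
-- 2u/v) below the number of arcs is shown to be at most q^(4/5 + δ); since rationals are dense,
-- this is the bound on the number of arcs.
theorem1 : (a b : ℕ) → 1 ≤ a → 1 ≤ b →
    Σ ℕ λ q₀ → (q : ℕ) → q₀ ≤ q → (F : FiniteField q) →
    (L : List (PointSet q)) → Unique L → All (IsArc F) L →
    (u v : ℕ) → 1 ≤ v →
    4 ^ u * 2 ^ (q * v) < length L ^ v →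
    u ^ (5 * b) ≤ q ^ (4 * b + 5 * a) * v ^ (5 * b)
-- This threshold is exactly what makes `C` at most q^(1/b).
theorem1 a b 1≤a _ = C ^ b , λ q q₀≤q F L uL arcs u v _ large →
  let 1≤q = ≤-trans (m^n>0 C {{>-nonZero (1≤constant (4 ^ 5) 100)}} b) q₀≤q
      w , w⁵≤q , count = count-≤ 1≤q F
  in absorb-constant C {w} a b 1≤a 1≤q q₀≤q w⁵≤q
       (exponent-from-count {q} {u = u} {v} {C * w ^ 4} (count L uL arcs) large)
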